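{- Let $k\ge 1$ be an integer and let $G$ be a graph of order $n$. Then $L_k(G)=k$ if and only if one of the following conditions holds: (i) $n=k$; (ii) $n=k+1$ and $\Delta(G)=k$; (iii) $n\geq k+2$ and for each $(k+1)$-subset $X$ of $V(G)$, either the induced subgraph $G[X]$ has maximum degree $k$, or the $k+1$ vertices of $X$ have a common neighbour in $G$.
   Context: All graphs are finite, undirected, simple and nontrivial (at least two vertices). $\Delta(G)$ is the maximum degree and $N[v]=\{v\}\cup N(v)$ is the closed neighbourhood of $v$. For an integer $k\ge 1$, a set $B\subseteq V(G)$ is a $k$-limited packing if $|N[v]\cap B|\le k$ for every vertex $v$ of $G$; $L_k(G)$ is the maximum cardinality of a $k$-limited packing in $G$. -}

module Defs where

open import Data.Bool.Base using (true; false)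
open import Data.Fin.Base using (Fin; zero; suc)
open import Data.Fin.Properties using (all?)
open import Data.Fin.Subset using (Subset; inside; outside; ⁅_⁆; _∩_; _∪_; _∈_; ∣_∣)
open import Data.List.Base using (List; []; _∷_; map; filter; allFin; cartesianProductWith)
open import Data.List.Extrema.Nat using (max)
open import Data.Nat.Base using (ℕ; zero; suc; _≤_)
open import Data.Nat.Properties using (_≤?_)
open import Data.Product.Base using (∃-syntax)
open import Data.Vec.Base as Vec using (Vec; []; _∷_)
open import Level using (0ℓ)
open import Relation.Binary.Core using (Rel)
open import Relation.Binary.Definitions using (Decidable; Symmetric)
open import Relation.Nullary using (¬_; does)
import Relation.Unary as U

-- Simple graphs of order n.  Nontriviality (2 ≤ n) is not built in, so that
-- every induced subgraph is again a Graph.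
record Graph (n : ℕ) : Set₁ where
  field
    Adj    : Rel (Fin n) 0ℓ
    adj?   : Decidable Adj
    symm   : Symmetric Adj
    irrefl : ∀ {v} → ¬ Adj v v

open Graph public

N : ∀ {n} → Graph n → Fin n → Subset n
N G v = Vec.tabulate λ w → does (adj? G v w)

N[_] : ∀ {n} → Graph n → Fin n → Subset n
N[ G ] v = ⁅ v ⁆ ∪ N G v

degree : ∀ {n} → Graph n → Fin n → ℕ
degree G v = ∣ N G v ∣

-- The first argument of max is its value on the empty list.
Δ : ∀ {n} → Graph n → ℕ
Δ {n} G = max 0 (map (degree G) (allFin n))

-- The increasing enumeration of the elements of X.
element : ∀ {n} (X : Subset n) → Fin ∣ X ∣ → Fin n
element (true  ∷ X) zero    = zero
element (true  ∷ X) (suc i) = suc (element X i)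
element (false ∷ X) i       = suc (element X i)

-- G[X], its vertices relabelled by Fin ∣ X ∣ along the enumeration of X.
induced : ∀ {n} → Graph n → (X : Subset n) → Graph ∣ X ∣
induced G X = record
  { Adj    = λ i j → Adj G (element X i) (element X j)
  ; adj?   = λ i j → adj? G (element X i) (element X j)
  ; symm   = symm G
  ; irrefl = irrefl G
  }

HaveCommonNeighbour : ∀ {n} → Graph n → Subset n → Set
HaveCommonNeighbour G X = ∃[ u ] (∀ x → x ∈ X → Adj G x u)

IsLimitedPacking : ∀ {n} → ℕ → Graph n → Subset n → Set
IsLimitedPacking k G B = ∀ v → ∣ N[ G ] v ∩ B ∣ ≤ k

isLimitedPacking? : ∀ {n} k (G : Graph n) → U.Decidable (IsLimitedPacking k G)
isLimitedPacking? k G B = all? λ v → ∣ N[ G ] v ∩ B ∣ ≤? k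

subsets : ∀ n → List (Subset n)
subsets zero    = [] ∷ []
subsets (suc n) = cartesianProductWith _∷_ (inside ∷ outside ∷ []) (subsets n)

-- The maximum is over a nonempty list, as the empty set is a k-limited
-- packing for every k; the default value 0 therefore plays no role.
L : ∀ {n} → ℕ → Graph n → ℕ
L {n} k G = max 0 (map ∣_∣ (filter (isLimitedPacking? k G) (subsets n)))

{-# OPTIONS --safe #-}

-- If n ≥ k then every k-subset is a k-limited packing, and packings are closed
-- under taking subsets, so L_k(G) = k exactly when n ≥ k and no (k+1)-subset X
-- is a packing, i.e. when every such X lies inside some N[v].  If v ∈ X this
-- says that v has degree k in G[X]; if v ∉ X it says that v is a common
-- neighbour of X.

module Submission where

open import Defs
open import Data.Fin.Base using (Fin; zero; suc)
open import Data.Fin.Properties using (_≟_; suc-injective; ¬∀⟶∃¬)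
open import Data.Fin.Subset using (Subset; inside; outside; ⊥; ⊤; ∁; ⁅_⁆; _∩_; _∈_; _⊆_; ∣_∣)
open import Data.Fin.Subset.Properties
open import Data.List.Base using ([]; _∷_; map; filter; allFin)
open import Data.List.Extrema.Nat using (max; max≤v⁺; argmax-sel; xs≤max)
open import Data.List.Membership.Propositional using () renaming (_∈_ to _∈ˡ_)
open import Data.List.Membership.Propositional.Properties
  using (∈-map⁺; ∈-map⁻; ∈-filter⁺; ∈-filter⁻; ∈-allFin; ∈-cartesianProductWith⁺)
import Data.List.Relation.Unary.All as All
open import Data.List.Relation.Unary.All.Properties using (map⁺)
open import Data.List.Relation.Unary.Any using (here; there)
open import Data.Nat.Base using (ℕ; zero; suc; _+_; _∸_; _≤_; z≤n; s≤s⁻¹)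
open import Data.Nat.Properties
  using (≤-refl; ≤-reflexive; ≤-trans; ≤-antisym; <⇒≤; <⇒≱; n≮n; ≰⇒>; ≮⇒≥;
         m≤n⇒m<n∨m≡n; +-comm; _≤?_)
open import Data.Product.Base using (_×_; _,_; proj₂; ∃-syntax)
open import Data.Sum.Base using (_⊎_; inj₁; inj₂)
open import Data.Vec.Base using ([]; _∷_; here; there)
open import Data.Vec.Properties using (lookup∘tabulate; lookup⇒[]=; []=⇒lookup)
open import Function.Base using (id; _∘_)
open import Function.Bundles using (_⇔_; mk⇔; Equivalence)
open import Relation.Binary.PropositionalEquality using (_≡_; refl; sym; trans; cong; subst)
open import Relation.Nullary using (yes; no; contradiction)
open import Relation.Nullary.Decidable using (dec-true)

open Equivalence using (to; from)

private
  variable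
    m n k : ℕ

-- Maxima of lists; sizes and enumerations of finite subsets.

∈⇒≤max : ∀ {x xs} → x ∈ˡ xs → x ≤ max 0 xs
∈⇒≤max {xs = xs} = All.lookup (xs≤max 0 xs)

-- A positive maximum cannot be the default `0`, so it is an entry of the list. Vertices of maximum
-- degree and packings of maximum size are obtained this way.
max≡suc⇒∈ : ∀ {xs} → max 0 xs ≡ suc k → suc k ∈ˡ xs
max≡suc⇒∈ {xs = xs} eq with argmax-sel id 0 xs
... | inj₁ max≡0 = contradiction (trans (sym eq) max≡0) λ ()
... | inj₂ max∈xs = subst (_∈ˡ xs) eq max∈xs

⊆∧∣≥∣⇒⊇ : {p q : Subset n} → p ⊆ q → ∣ q ∣ ≤ ∣ p ∣ → q ⊆ p
⊆∧∣≥∣⇒⊇ {p = p} p⊆q ∣q∣≤∣p∣ {x} x∈q with x ∈? p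
... | yes x∈p = x∈p
... | no x∉p = contradiction ∣q∣≤∣p∣ (<⇒≱ (p⊂q⇒∣p∣<∣q∣ (p⊆q , x , x∈q , x∉p)))

subset-of-size : (p : Subset n) → m ≤ ∣ p ∣ → ∃[ q ] q ⊆ p × ∣ q ∣ ≡ m
subset-of-size {n} {zero} p _ = ⊥ , ⊥⊆ , ∣⊥∣≡0 n
subset-of-size {m = suc m} (inside ∷ p) m<∣p∣ with subset-of-size p (s≤s⁻¹ m<∣p∣)
... | q , q⊆p , refl = inside ∷ q , s⊆s q⊆p , refl
subset-of-size {m = suc m} (outside ∷ p) m<∣p∣ with subset-of-size p m<∣p∣
... | q , q⊆p , eq = outside ∷ q , s⊆s q⊆p , eq

∈-subsets : (p : Subset n) → p ∈ˡ subsets n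
∈-subsets [] = here refl
∈-subsets (inside ∷ p) =
  ∈-cartesianProductWith⁺ _∷_ {xs = inside ∷ outside ∷ []} (here refl) (∈-subsets p)
∈-subsets (outside ∷ p) =
  ∈-cartesianProductWith⁺ _∷_ {xs = inside ∷ outside ∷ []} (there (here refl)) (∈-subsets p)

element-∈ : (X : Subset n) (i : Fin ∣ X ∣) → element X i ∈ X
element-∈ (inside ∷ X) zero = here
element-∈ (inside ∷ X) (suc i) = there (element-∈ X i)
element-∈ (outside ∷ X) i = there (element-∈ X i)

element-injective : (X : Subset n) {i j : Fin ∣ X ∣} → element X i ≡ element X j → i ≡ j
element-injective (inside ∷ X) {zero} {zero} _ = refl
element-injective (inside ∷ X) {suc i} {suc j} eq =
  cong suc (element-injective X (suc-injective eq))
element-injective (outside ∷ X) eq = element-injective X (suc-injective eq)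

element-surjective : (X : Subset n) {x : Fin n} → x ∈ X → ∃[ i ] element X i ≡ x
element-surjective (inside ∷ X) here = zero , refl
element-surjective (inside ∷ X) (there x∈X) with element-surjective X x∈X
... | i , refl = suc i , refl
element-surjective (outside ∷ X) (there x∈X) with element-surjective X x∈X
... | i , refl = i , refl

-- Membership in open and closed neighbourhoods.

module _ (G : Graph n) {v w : Fin n} where

  ∈N⁺ : Adj G v w → w ∈ N G v
  ∈N⁺ vw = lookup⇒[]= w _ (trans (lookup∘tabulate _ w) (dec-true (adj? G v w) vw))

  ∈N⁻ : w ∈ N G v → Adj G v w
  ∈N⁻ w∈N with adj? G v w | trans (sym (lookup∘tabulate _ w)) ([]=⇒lookup w∈N)
  ... | yes vw | _ = vw

  ∈N[]⁺ : w ≡ v ⊎ Adj G v w → w ∈ N[ G ] v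
  ∈N[]⁺ (inj₁ refl) = x∈p∪q⁺ (inj₁ (x∈⁅x⁆ w))
  ∈N[]⁺ (inj₂ vw) = x∈p∪q⁺ (inj₂ (∈N⁺ vw))

  ∈N[]⁻ : w ∈ N[ G ] v → w ≡ v ⊎ Adj G v w
  ∈N[]⁻ w∈N[] with x∈p∪q⁻ _ _ w∈N[]
  ... | inj₁ w∈⁅v⁆ = inj₁ (x∈⁅y⁆⇒x≡y v w∈⁅v⁆)
  ... | inj₂ w∈N = inj₂ (∈N⁻ w∈N)

-- Dominating vertices in graphs of order `suc k`.

∣∁⁅v⁆∣ : (v : Fin (suc k)) → ∣ ∁ ⁅ v ⁆ ∣ ≡ k
∣∁⁅v⁆∣ {k} v = trans (∣∁p∣≡n∸∣p∣ ⁅ v ⁆) (cong (suc k ∸_) (∣⁅x⁆∣≡1 v))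

N⊆∁⁅v⁆ : (G : Graph n) (v : Fin n) → N G v ⊆ ∁ ⁅ v ⁆
N⊆∁⁅v⁆ G v w∈N = x∉p⇒x∈∁p λ w∈⁅v⁆ →
  irrefl G (subst (Adj G v) (x∈⁅y⁆⇒x≡y v w∈⁅v⁆) (∈N⁻ G w∈N))

-- The order is suc k only propositionally because that of G[X] is ∣ X ∣.
degree≤ : n ≡ suc k → (G : Graph n) (v : Fin n) → degree G v ≤ k
degree≤ refl G v =
  subst (degree G v ≤_) (∣∁⁅v⁆∣ v) (p⊆q⇒∣p∣≤∣q∣ {p = N G v} {q = ∁ ⁅ v ⁆} (N⊆∁⁅v⁆ G v))

-- `N G v` lies in the complement of `v`, which has exactly `k` elements, so degree `k` forces the
-- two sets to coincide.
degree≡⇒dominating : n ≡ suc k → (G : Graph n) (v : Fin n) → degree G v ≡ k → ⊤ ⊆ N[ G ] v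
degree≡⇒dominating refl G v deg≡k {w} _ with w ≟ v
... | yes w≡v = ∈N[]⁺ G (inj₁ w≡v)
... | no w≢v = ∈N[]⁺ G (inj₂ (∈N⁻ G (∁⁅v⁆⊆N (x∉p⇒x∈∁p (x≢y⇒x∉⁅y⁆ w≢v)))))
  where
  ∁⁅v⁆⊆N : ∁ ⁅ v ⁆ ⊆ N G v
  ∁⁅v⁆⊆N = ⊆∧∣≥∣⇒⊇ (N⊆∁⁅v⁆ G v) (≤-reflexive (trans (∣∁⁅v⁆∣ v) (sym deg≡k)))

dominating⇒≤degree : n ≡ suc k → (G : Graph n) (v : Fin n) → ⊤ ⊆ N[ G ] v → k ≤ degree G v
dominating⇒≤degree refl G v dom =
  subst (_≤ degree G v) (∣∁⁅v⁆∣ v) (p⊆q⇒∣p∣≤∣q∣ {p = ∁ ⁅ v ⁆} {q = N G v} ∁⁅v⁆⊆N)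
  where
  ∁⁅v⁆⊆N : ∁ ⁅ v ⁆ ⊆ N G v
  ∁⁅v⁆⊆N {w} w∈∁ with ∈N[]⁻ G (dom (∈⊤ {x = w}))
  ... | inj₁ refl = contradiction (x∈⁅x⁆ v) (x∈∁p⇒x∉p w∈∁)
  ... | inj₂ vw = ∈N⁺ G vw

degree≤Δ : (G : Graph n) (v : Fin n) → degree G v ≤ Δ G
degree≤Δ G v = ∈⇒≤max (∈-map⁺ (degree G) (∈-allFin v))

Δ≤ : (G : Graph n) → (∀ v → degree G v ≤ k) → Δ G ≤ k
Δ≤ {n} G deg≤k =
  max≤v⁺ {xs = map (degree G) (allFin n)} z≤n (map⁺ (All.universal deg≤k (allFin n)))

Δ-attained : (G : Graph n) → Δ G ≡ suc k → ∃[ v ] degree G v ≡ suc k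
Δ-attained {n} G Δ≡ =
  let v , _ , eq = ∈-map⁻ (degree G) (max≡suc⇒∈ {xs = map (degree G) (allFin n)} Δ≡)
  in v , sym eq

-- Serves twice: for `G` itself when its order is `suc k`, and for `G[X]`. Positivity of `k` lets
-- `Δ-attained` supply the vertex.
Δ≡⇔dominating : 1 ≤ k → n ≡ suc k → (G : Graph n) →
                (Δ G ≡ k) ⇔ (∃[ v ] ⊤ ⊆ N[ G ] v)
Δ≡⇔dominating {suc k} _ n≡ G = mk⇔ dominating full
  where
  dominating : Δ G ≡ suc k → ∃[ v ] ⊤ ⊆ N[ G ] v
  dominating Δ≡ = let v , deg≡ = Δ-attained G Δ≡ in v , degree≡⇒dominating n≡ G v deg≡

  full : ∃[ v ] ⊤ ⊆ N[ G ] v → Δ G ≡ suc k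
  full (v , dom) =
    ≤-antisym (Δ≤ G (degree≤ n≡ G)) (≤-trans (dominating⇒≤degree n≡ G v dom) (degree≤Δ G v))

-- Subsets of size `suc k` inside a closed neighbourhood.

⊆N[]⇔ : 1 ≤ k → (G : Graph n) (X : Subset n) → ∣ X ∣ ≡ suc k →
        (∃[ v ] X ⊆ N[ G ] v) ⇔ (Δ (induced G X) ≡ k ⊎ HaveCommonNeighbour G X)
⊆N[]⇔ {k} 1≤k G X ∣X∣≡ = mk⇔ split cover
  where
  Δ⇔ = Δ≡⇔dominating 1≤k ∣X∣≡ (induced G X)

  split : ∃[ v ] X ⊆ N[ G ] v → Δ (induced G X) ≡ k ⊎ HaveCommonNeighbour G X
  split (v , X⊆) with v ∈? X
  ... | no v∉X = inj₂ (v , adj)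
    where
    adj : ∀ x → x ∈ X → Adj G x v
    adj x x∈X with ∈N[]⁻ G (X⊆ x∈X)
    ... | inj₁ refl = contradiction x∈X v∉X
    ... | inj₂ vx = symm G vx
  ... | yes v∈X with element-surjective X v∈X
  -- With `v` written as `element X i`, adjacency in `G[X]` is by definition adjacency in `G`; only
  -- the case of equal vertices needs the injectivity of the enumeration.
  ...   | i , refl = inj₁ (from Δ⇔ (i , λ {j} _ → ∈N[]⁺ (induced G X) (case j)))
    where
    case : ∀ j → j ≡ i ⊎ Adj G (element X i) (element X j)
    case j with ∈N[]⁻ G (X⊆ (element-∈ X j))
    ... | inj₁ eq = inj₁ (element-injective X eq)
    ... | inj₂ a = inj₂ a

  cover : Δ (induced G X) ≡ k ⊎ HaveCommonNeighbour G X → ∃[ v ] X ⊆ N[ G ] v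
  cover (inj₂ (u , adj)) = u , λ x∈X → ∈N[]⁺ G (inj₂ (symm G (adj _ x∈X)))
  cover (inj₁ Δ≡k) with to Δ⇔ Δ≡k
  ... | i , dom = element X i , λ x∈X → case (element-surjective X x∈X)
    where
    case : ∀ {x} → ∃[ j ] element X j ≡ x → x ∈ N[ G ] (element X i)
    case (j , refl) with ∈N[]⁻ (induced G X) (dom (∈⊤ {x = j}))
    ... | inj₁ refl = ∈N[]⁺ G (inj₁ refl)
    ... | inj₂ a = ∈N[]⁺ G (inj₂ a)

-- Limited packings, and the case split on the order.

packing⇒∣∣≤L : ∀ k (G : Graph n) {B} → IsLimitedPacking k G B → ∣ B ∣ ≤ L k G
packing⇒∣∣≤L k G {B} packing =
  ∈⇒≤max (∈-map⁺ ∣_∣ (∈-filter⁺ (isLimitedPacking? k G) (∈-subsets B) packing))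

L≡k⇔covered : 1 ≤ k → (G : Graph n) →
              (L k G ≡ k) ⇔ (k ≤ n × (∀ X → ∣ X ∣ ≡ suc k → ∃[ v ] X ⊆ N[ G ] v))
L≡k⇔covered {suc k} {n} _ G = mk⇔
  (λ L≡k → order L≡k , λ X → covered L≡k X)
  (λ (k≤n , cov) → ≤-antisym (upper cov) (lower k≤n))
  where
  K = suc k

  order : L K G ≡ K → K ≤ n
  -- `K` is positive, hence the size of an actual packing, which is a set of at most `n` vertices.
  order L≡k with ∈-map⁻ ∣_∣ {xs = filter (isLimitedPacking? K G) (subsets n)} (max≡suc⇒∈ L≡k)
  ... | B , _ , eq = subst (_≤ n) (sym eq) (∣p∣≤n B)

  covered : L K G ≡ K → ∀ X → ∣ X ∣ ≡ suc K → ∃[ v ] X ⊆ N[ G ] v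
  -- Were `X` a packing, `L K G` would exceed `K`; so the bound fails at some vertex, which a finite
  -- search finds.
  covered L≡k X ∣X∣≡ with ¬∀⟶∃¬ n _ (λ v → ∣ N[ G ] v ∩ X ∣ ≤? K)
    (λ packing → n≮n K (subst (_≤ K) ∣X∣≡ (subst (∣ X ∣ ≤_) L≡k (packing⇒∣∣≤L K G packing))))
  -- More than `K` of the `suc K` elements of `X` lie in `N[ G ] v`, so all of them do.
  ... | v , large = v , λ x∈X →
    p∩q⊆p (N[ G ] v) X (⊆∧∣≥∣⇒⊇ {p = N[ G ] v ∩ X} (p∩q⊆q (N[ G ] v) X)
      (subst (_≤ ∣ N[ G ] v ∩ X ∣) (sym ∣X∣≡) (≰⇒> large)) x∈X)

  -- A larger `B` would contain some `X` of size `suc K`, and the vertex covering `X` would see too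
  -- many elements of `B`.
  packing≤ : (∀ X → ∣ X ∣ ≡ suc K → ∃[ v ] X ⊆ N[ G ] v) →
             ∀ {B} → IsLimitedPacking K G B → ∣ B ∣ ≤ K
  packing≤ cov {B} packing = ≮⇒≥ λ K<∣B∣ →
    let X , X⊆B , ∣X∣≡ = subset-of-size B K<∣B∣
        v , X⊆N = cov X ∣X∣≡
    in n≮n K (≤-trans (subst (_≤ ∣ N[ G ] v ∩ B ∣) ∣X∣≡
         (p⊆q⇒∣p∣≤∣q∣ λ x∈X → x∈p∩q⁺ (X⊆N x∈X , X⊆B x∈X))) (packing v))

  upper : (∀ X → ∣ X ∣ ≡ suc K → ∃[ v ] X ⊆ N[ G ] v) → L K G ≤ K
  upper cov = max≤v⁺ {xs = map ∣_∣ (filter (isLimitedPacking? K G) (subsets n))} z≤n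
    (map⁺ (All.tabulate λ B∈ → packing≤ cov (proj₂ (∈-filter⁻ (isLimitedPacking? K G) {xs = subsets n} B∈))))

  lower : K ≤ n → K ≤ L K G
  lower K≤n =
    -- Any `K` vertices form a packing, since `N[ G ] v ∩ B` is never larger than `B`.
    let B , _ , ∣B∣≡ = subset-of-size ⊤ (subst (K ≤_) (sym (∣⊤∣≡n n)) K≤n)
    in subst (_≤ L K G) ∣B∣≡ (packing⇒∣∣≤L K G λ v →
         subst (∣ N[ G ] v ∩ B ∣ ≤_) ∣B∣≡ (∣p∩q∣≤∣q∣ (N[ G ] v) B))

theorem3p4 : (k : ℕ) → 1 ≤ k → (n : ℕ) → 2 ≤ n → (G : Graph n) →
    (L k G ≡ k) ⇔
    ((n ≡ k)
    ⊎ (n ≡ k + 1 × Δ G ≡ k)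
    ⊎ (k + 2 ≤ n × ((X : Subset n) → ∣ X ∣ ≡ k + 1 →
    (Δ (induced G X) ≡ k) ⊎ HaveCommonNeighbour G X)))
-- In the forms `suc k` and `2 + k`, the strict inequalities from splitting `k ≤ n` twice are
-- literally the bounds in the conditions.
theorem3p4 k 1≤k n _ G rewrite +-comm k 1 | +-comm k 2 = mk⇔ (forth ∘ to L⇔) (from L⇔ ∘ back)
  where
  L⇔ = L≡k⇔covered 1≤k G

  Covered : Set
  Covered = ∀ X → ∣ X ∣ ≡ suc k → ∃[ v ] X ⊆ N[ G ] v

  Conditions : Set
  Conditions = n ≡ k ⊎ (n ≡ suc k × Δ G ≡ k)
    ⊎ (2 + k ≤ n × (∀ X → ∣ X ∣ ≡ suc k → Δ (induced G X) ≡ k ⊎ HaveCommonNeighbour G X))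

  forth : k ≤ n × Covered → Conditions
  forth (k≤n , cov) with m≤n⇒m<n∨m≡n k≤n
  ... | inj₂ k≡n = inj₁ (sym k≡n)
  ... | inj₁ k<n with m≤n⇒m<n∨m≡n k<n
  -- Here `⊤` itself has size `suc k`, so covering it gives a dominating vertex.
  ...   | inj₂ k+1≡n = inj₂ (inj₁ (sym k+1≡n ,
    from (Δ≡⇔dominating 1≤k (sym k+1≡n) G) (cov ⊤ (trans (∣⊤∣≡n n) (sym k+1≡n)))))
  ...   | inj₁ k+1<n = inj₂ (inj₂ (k+1<n , λ X ∣X∣≡ → to (⊆N[]⇔ 1≤k G X ∣X∣≡) (cov X ∣X∣≡)))

  back : Conditions → k ≤ n × Covered
  -- Covering is vacuous: no set of `n` vertices can have size `suc n`.
  back (inj₁ refl) = ≤-refl , λ X ∣X∣≡ → contradiction (subst (_≤ n) ∣X∣≡ (∣p∣≤n X)) (n≮n n)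
  back (inj₂ (inj₁ (n≡ , Δ≡k))) with to (Δ≡⇔dominating 1≤k n≡ G) Δ≡k
  -- The dominating `v` covers every `X` at once.
  ... | v , dom = subst (k ≤_) (sym n≡) (<⇒≤ ≤-refl) , λ X _ → v , λ _ → dom ∈⊤
  back (inj₂ (inj₂ (k+1<n , h))) =
    <⇒≤ (<⇒≤ k+1<n) , λ X ∣X∣≡ → from (⊆N[]⇔ 1≤k G X ∣X∣≡) (h X ∣X∣≡)
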